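{- For each integer $k\ge 1$ let $G_k$ be the graph defined in the context below. Then the clique-width of the graphs $G_k$ is unbounded: for every integer $w$ there is some $k$ such that $G_k$ has clique-width greater than $w$.
   Context: A confluent drawing consists of finitely many smooth curves (called tracks) in a closed region of the plane, pairwise disjoint except at shared endpoints. Each endpoint of a track is either a vertex of the graph or a junction, a point where three or more tracks meet, all having the same tangent slope there. An edge curve is a smooth curve contained in the union of the tracks that starts and ends at vertices and otherwise passes only through tracks and junctions. The graph represented by the drawing has the drawing's vertices as vertices, two distinct vertices being adjacent exactly when some edge curve connects them. Construction of $G_k$: work in the closed upper half-plane. On the horizontal boundary line place $3^k$ vertices $v_0,v_1,\dots,v_{3^k-1}$ from left to right, and join each consecutive pair $v_t,v_{t+1}$ by a straight track along the line. Vertices with odd index have no other incident tracks. The remaining tracks are arranged into $k$ levels $0,1,\dots,k-1$ (bottom to top), level $i$ being a horizontal slab between two horizontal lines. The bottom line of level $i$ contains $\lceil 3^{k-i}/2\rceil$ points $p_{i,j}$, $0\le j<3^{k-i}/2$, ordered left to right, at which tracks enter level $i$ with vertical tangent; the points $p_{0,j}$ are the even-indexed vertices $v_{2j}$, and for $i\ge 1$ the points $p_{i,j}$ are junctions. Within level $i$, each two consecutive points $p_{i,j},p_{i,j+1}$ are joined by a semicircle. If $j$ is a multiple of $3$, this semicircle is subdivided by two junctions into three circular arcs (each a track, each spanning angle $\pi/3$); otherwise the semicircle is a single track. Exception: at the top level $k-1$ the single semicircle joining $p_{k-1,0}$ and $p_{k-1,1}$ is not subdivided. For each level $i<k-1$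 and each subdivided semicircle joining $p_{i,j}$ and $p_{i,j+1}$ ($j$ a multiple of $3$), add two tracks (circular arcs congruent to the arcs of the semicircle) from the two subdivision junctions upward to the point $p_{i+1,j/3}$ (located directly above the center of the semicircle and reached with vertical tangent): the track from the left subdivision point continues smoothly the arc ending at $p_{i,j}$, and the track from the right subdivision point continues smoothly the arc ending at $p_{i,j+1}$, so that $p_{i+1,j/3}$ is connected downward by smooth curves through the semicircle to both $p_{i,j}$ and $p_{i,j+1}$. $G_k$ is the graph represented by this confluent drawing; it has $3^k$ vertices. Clique-width: the minimum number of colors needed to construct the graph by the operations: create a single vertex with any color; disjoint union of two colored graphs; recolor all vertices of one color to another color; add all edges between vertices of two specified colors. -}

module Defs where

open import Data.Nat using (ℕ; zero; suc; _+_; _*_; _∸_; _^_; _<_; _≤_)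
open import Data.Nat.Divisibility using (_∣_)
open import Data.Fin using (Fin; toℕ; splitAt)
open import Data.Bool using (Bool; true; false; not; if_then_else_)
open import Data.Sum using (_⊎_; [_,_]′; inj₁; inj₂)
open import Data.Product using (Σ; _×_; _,_; ∃; ∃-syntax)
open import Data.Empty using (⊥)
open import Relation.Nullary using (¬_; does)
open import Relation.Binary.PropositionalEquality using (_≡_; _≢_)
open import Function.Bundles using (_↔_; _⇔_; Inverse)
import Data.Fin as F

Graph : ℕ → Set₁
Graph N = Fin N → Fin N → Set

-- Clique-width expressions with colours (labels) Fin w.
-- 'Expr w n' is a w-expression building a graph on n vertices
-- (the vertices are numbered Fin n, in creation order).

data Expr (w : ℕ) : ℕ → Set where
  single  : Fin w → Expr w 1
  union   : ∀ {m n} → Expr w m → Expr w n → Expr w (m + n)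
  recolor : ∀ {n} → Fin w → Fin w → Expr w n → Expr w n
  join    : ∀ {n} (a b : Fin w) → a ≢ b → Expr w n → Expr w n

colour : ∀ {w n} → Expr w n → Fin n → Fin w
colour (single a) _ = a
colour (union {m} e f) x = [ colour e , colour f ]′ (splitAt m x)
colour (recolor a b e) x = if does (colour e x F.≟ a) then b else colour e x
colour (join a b _ e) x = colour e x

Adj : ∀ {w n} → Expr w n → Fin n → Fin n → Set
Adj (single a) x y = ⊥
Adj (union {m} e f) x y with splitAt m x | splitAt m y
... | inj₁ x′ | inj₁ y′ = Adj e x′ y′
... | inj₂ x′ | inj₂ y′ = Adj f x′ y′
... | _       | _       = ⊥
Adj (recolor a b e) x y = Adj e x y
Adj (join a b _ e) x y =
  Adj e x y ⊎ ((colour e x ≡ a × colour e y ≡ b) ⊎ (colour e x ≡ b × colour e y ≡ a))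

CliqueWidth≤ : ∀ {N} → ℕ → Graph N → Set
CliqueWidth≤ {N} w G =
  ∃[ n ] Σ (Expr w n) λ e → Σ (Fin n ↔ Fin N) λ σ →
    ∀ x y → (Adj e x y ⇔ G (Inverse.to σ x) (Inverse.to σ y))

-- Combinatorial confluent drawings.
-- Each junction has a tangent line; the tracks ending there lie on one of
-- its two sides (Bool). A smooth curve passing through a junction must
-- arrive from one side and leave on the other side.

data Endpoint (V J : Set) : Set where
  vertex : V → Endpoint V J
  junc   : J → Bool → Endpoint V J

record Drawing : Set₁ where
  field
    Vertex   : Set
    Junction : Set
    Track    : Set
    end      : Track → Bool → Endpoint Vertex Junction

module _ (D : Drawing) where
  open Drawing D

  Dart : Set
  Dart = Track × Bool

  start target : Dart → Endpoint Vertex Junction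
  start (t , b) = end t b
  target (t , b) = end t (not b)

  -- a smooth curve in the tracks from the point p to vertex v, passing
  -- only through junctions (smoothly) in between
  data Trail (p : Endpoint Vertex Junction) (v : Vertex) : Set where
    stop : (d : Dart) → start d ≡ p → target d ≡ vertex v → Trail p v
    go   : (d : Dart) (j : Junction) (s : Bool) → start d ≡ p →
           target d ≡ junc j s → Trail (junc j (not s)) v → Trail p v

  Adjacent : Vertex → Vertex → Set
  Adjacent u v = u ≢ v × Trail (vertex u) v

-- The drawing of G_k.  Vertices v_t are labelled by t : ℕ (t < 3^k).
-- p_{0,j} = v_{2j};  p_{i,j} (i ≥ 1) is the junction pt i j.
-- The semicircle joining p_{i,j}, p_{i,j+1} is the semicircle (i,j);
-- a subdivided one has j = 3m and is indexed by (i,m), with subdivision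
-- junctions subL i m (left) and subR i m (right).

data JName : Set where
  pt   : ℕ → ℕ → JName
  subL : ℕ → ℕ → JName
  subR : ℕ → ℕ → JName

data TName : Set where
  line  : ℕ → TName
  whole : ℕ → ℕ → TName
  arcL  : ℕ → ℕ → TName
  arcM  : ℕ → ℕ → TName
  arcR  : ℕ → ℕ → TName
  upL   : ℕ → ℕ → TName
  upR   : ℕ → ℕ → TName

-- semicircle (i,j) exists in level i (both p_{i,j}, p_{i,j+1} exist)
SemiOK : ℕ → ℕ → ℕ → Set
SemiOK k i j = i < k × 2 * suc j < 3 ^ (k ∸ i)

Subdiv : ℕ → ℕ → ℕ → Set
Subdiv k i j = 3 ∣ j × suc i < k

ValidT : ℕ → TName → Set
ValidT k (line t)    = suc t < 3 ^ k
ValidT k (whole i j) = SemiOK k i j × ¬ Subdiv k i j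
ValidT k (arcL i m)  = SemiOK k i (3 * m) × Subdiv k i (3 * m)
ValidT k (arcM i m)  = SemiOK k i (3 * m) × Subdiv k i (3 * m)
ValidT k (arcR i m)  = SemiOK k i (3 * m) × Subdiv k i (3 * m)
ValidT k (upL i m)   = SemiOK k i (3 * m) × Subdiv k i (3 * m)
ValidT k (upR i m)   = SemiOK k i (3 * m) × Subdiv k i (3 * m)

-- the point p_{i,j}, as the end of a semicircle of level i
-- (side true = upper side, where the level-i semicircles start;
--  side false = lower side, where the upward tracks from level i-1 arrive)
pEnd : ℕ → ℕ → Endpoint ℕ JName
pEnd zero    j = vertex (2 * j)
pEnd (suc i) j = junc (pt (suc i) j) true

endT : TName → Bool → Endpoint ℕ JName
endT (line t)    false = vertex t
endT (line t)    true  = vertex (suc t)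
endT (whole i j) false = pEnd i j
endT (whole i j) true  = pEnd i (suc j)
endT (arcL i m)  false = pEnd i (3 * m)
endT (arcL i m)  true  = junc (subL i m) false
endT (arcM i m)  false = junc (subL i m) true
endT (arcM i m)  true  = junc (subR i m) true
endT (arcR i m)  false = junc (subR i m) false
endT (arcR i m)  true  = pEnd i (suc (3 * m))
endT (upL i m)   false = junc (subL i m) true
endT (upL i m)   true  = junc (pt (suc i) m) false
endT (upR i m)   false = junc (subR i m) true
endT (upR i m)   true  = junc (pt (suc i) m) false

drawingG : ℕ → Drawing
drawingG k = record
  { Vertex   = ℕ
  ; Junction = JName
  ; Track    = Σ TName (ValidT k)
  ; end      = λ t b → endT (Data.Product.proj₁ t) b
  }

G : (k : ℕ) → Graph (3 ^ k)
G k x y = Adjacent (drawingG k) (toℕ x) (toℕ y)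

{-# OPTIONS --safe #-}
module Submission where

-- Two even-indexed vertices v_{2a}, v_{2b} are adjacent through level l iff a and b have only
-- ternary digits 0 and 1 below position l and ⌊a/3^l⌋, ⌊b/3^l⌋ differ by one.  In an expression
-- with w colours, the vertex set A of a subexpression has at most w classes of vertices with the
-- same neighbours outside A.  Odd-indexed vertices have only their two path neighbours, so a path
-- edge leaving A is nearly determined by the colour of its end in A.  Take 2w+1 well separated
-- intervals of the path and A minimal containing one of them.  If A met all of them, each would be
-- split by A or by its left child, and two would be split at ends of the same colour; so A misses
-- one.  Between the contained and the missed interval, every scale 3^i provides an edge leaving A
-- at level i or i+1.  Working from small scales to large, each new edge can be taken far from all
-- the earlier ones, which are too low to reach it; then its end in A has a new colour, and w+1
-- scales give a contradiction.

open import Defs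
open import Data.Bool as Bool using (Bool; true; false; not; if_then_else_)
open import Data.Bool.Properties using (¬-not; not-¬; not-involutive)
open import Data.Empty using (⊥; ⊥-elim)
open import Data.Fin as Fin using (Fin; toℕ; splitAt; _↑ˡ_; _↑ʳ_; fromℕ<)
open import Data.Fin.Properties using (any?; all?; ¬∀⟶∃¬; splitAt-↑ˡ; splitAt-↑ʳ; join-splitAt; splitAt-join; pigeonhole; toℕ-fromℕ<; toℕ<n)
open import Data.Nat using (ℕ; zero; suc; _+_; _*_; _∸_; _^_; _%_; _≤_; _<_; z≤n; s≤s; _≤?_; _<?_; _≟_)
open import Data.Nat.Divisibility using (_∣?_; divides; m∣m*n)
open import Data.Nat.DivMod using ([m+kn]%n≡m%n)
open import Data.Nat.Properties
open import Data.Nat.Tactic.RingSolver using (solve-∀)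
open import Data.Product using (Σ-syntax; _×_; _,_; ∃; ∃-syntax; ∃₂; proj₁; proj₂)
open import Data.Sum as Sum using (_⊎_; inj₁; inj₂; swap; [_,_]′)
open import Data.Sum.Properties using (inj₁-injective; inj₂-injective)
open import Function using (_∘_; id; _⇔_; Equivalence; Inverse; mk⇔)
open import Relation.Binary.PropositionalEquality
open import Relation.Nullary using (¬_; Dec; yes; no; does)
open import Relation.Nullary.Decidable using (_×-dec_; _⊎-dec_; dec-true)

-- Ternary description of the vertices below a point.

-- Below i j a: some smooth curve descends from p_{i,j} to v_{2a}.  In base 3, the i low digits
-- of a are 0 or 1, and the remaining ones are those of j.
Below : ℕ → ℕ → ℕ → Set
Below zero    j a = a ≡ j
Below (suc i) j a = Below i (3 * j) a ⊎ Below i (suc (3 * j)) a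

regroup : ∀ j x → j * (3 * x) ≡ 3 * j * x
regroup = solve-∀

below-lower : ∀ i {j a} → Below i j a → j * 3 ^ i ≤ a
below-lower zero    {j} refl = ≤-reflexive (*-identityʳ j)
below-lower (suc i) {j} (inj₁ b) = ≤-trans (≤-reflexive (regroup j (3 ^ i))) (below-lower i b)
below-lower (suc i) {j} (inj₂ b) = ≤-trans (≤-reflexive (regroup j (3 ^ i)))
  (≤-trans (*-monoˡ-≤ (3 ^ i) (n≤1+n (3 * j))) (below-lower i b))

below-upper : ∀ i {j a} → Below i j a → a < suc j * 3 ^ i
below-upper zero    {j} refl = s≤s (≤-reflexive (sym (*-identityʳ j)))
below-upper (suc i) {j} b = ≤-trans (child b) (≤-reflexive (sym (regroup (suc j) (3 ^ i))))
  where
  3+ : ∀ n → suc (suc (suc (3 * n))) ≡ 3 * suc n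
  3+ = solve-∀
  child : ∀ {a} → Below (suc i) j a → a < 3 * suc j * 3 ^ i
  child (inj₁ b) = ≤-trans (below-upper i b) (*-monoˡ-≤ (3 ^ i) (≤-trans (≤-trans (n≤1+n _) (n≤1+n _)) (≤-reflexive (3+ j))))
  child (inj₂ b) = ≤-trans (below-upper i b) (*-monoˡ-≤ (3 ^ i) (≤-trans (n≤1+n _) (≤-reflexive (3+ j))))

-- The blocks [j·3^i, (j+1)·3^i) containing everything below p_{i,j} are disjoint for different `j`.
below-unique : ∀ i {j j' a} → Below i j a → Below i j' a → j ≡ j'
below-unique i {j} {j'} {a} b b' = ≤-antisym (half j j' b b') (half j' j b' b)
  where
  half : ∀ j j' → Below i j a → Below i j' a → j ≤ j'
  half j j' b b' = ≤-pred (*-cancelʳ-< (3 ^ i) j (suc j') (≤-<-trans (below-lower i b) (below-upper i b')))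

below-antitone : ∀ {l μ n a} → μ ≤ l → Below l n a → ∃[ m ] Below μ m a
below-antitone {zero}  {n = n} z≤n b = n , b
below-antitone {suc l} {n = n} μ≤ b with m≤n⇒m<n∨m≡n μ≤
... | inj₂ refl = n , b
... | inj₁ (s≤s μ≤l) with b
...   | inj₁ b' = below-antitone {l} μ≤l b'
...   | inj₂ b' = below-antitone {l} μ≤l b'

below-left : ∀ i j → Below i j (j * 3 ^ i)
below-left zero    j = *-identityʳ j
below-left (suc i) j = inj₁ (subst (Below i (3 * j)) (sym (regroup j (3 ^ i))) (below-left i (3 * j)))

-- In ternary, a single digit 1 is placed at position `g` behind the digits of `j`, and the other
-- low digits are 0.
below-power : ∀ i j {g} → g < i → Below i j (j * 3 ^ i + 3 ^ g)
below-power (suc i) j {g} g<i with m≤n⇒m<n∨m≡n g<i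
... | inj₂ refl = inj₂ (subst (Below i (suc (3 * j))) (lead j (3 ^ i)) (below-left i (suc (3 * j))))
  where
  lead : ∀ j x → suc (3 * j) * x ≡ j * (3 * x) + x
  lead = solve-∀
... | inj₁ (s≤s g<i') = inj₁ (subst (Below i (3 * j)) (cong (_+ 3 ^ g) (sym (regroup j (3 ^ i)))) (below-power i (3 * j) g<i'))

-- From smooth curves to arithmetic.

-- Smooth curves through the semicircle joining p_{l,n} and p_{l,n+1}.
Across : ℕ → ℕ → ℕ → ℕ → Set
Across l n a b = (Below l n a × Below l (suc n) b) ⊎ (Below l (suc n) a × Below l n b)

across-sym : ∀ {l n a b} → Across l n a b → Across l n b a
across-sym (inj₁ (x , y)) = inj₂ (y , x)
across-sym (inj₂ (x , y)) = inj₁ (y , x)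

OnLine : ℕ → ℕ → Set
OnLine u v = v ≡ suc u ⊎ u ≡ suc v

-- Bounds depending on `k` are dropped: this is a necessary condition for adjacency in every `G k`.
-- The converse is shown separately under size bounds.
Edge : ℕ → ℕ → Set
Edge u v = OnLine u v ⊎ ∃₂ λ a b → u ≡ 2 * a × v ≡ 2 * b × ∃₂ λ l n → Across l n a b

Descends : ℕ → ℕ → ℕ → Set
Descends i j v = ∃[ b ] v ≡ 2 * b × Below i j b

-- Universal in `a`, because the way a curve continues above p_{i,j} does not depend on the vertex
-- from which it climbed.
Ascends : ℕ → ℕ → ℕ → Set
Ascends i j v = ∃[ b ] v ≡ 2 * b × ∃₂ λ l n → ∀ {a} → Below i j a → Across l n a b

-- The invariant of a trail, by the side on which it leaves a point. From side `true` of a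
-- subdivision junction it either crosses the middle arc and descends at the far end of the
-- semicircle, or climbs to p_{i+1,m}.
Reach : Endpoint ℕ JName → ℕ → Set
Reach (vertex u)            v = Edge u v
Reach (junc (pt i j) false) v = Descends i j v
Reach (junc (pt i j) true)  v = Ascends i j v
Reach (junc (subL i m) false) v = Descends i (3 * m) v
Reach (junc (subL i m) true)  v = Descends i (suc (3 * m)) v ⊎ Ascends (suc i) m v
Reach (junc (subR i m) false) v = Descends i (suc (3 * m)) v
Reach (junc (subR i m) true)  v = Descends i (3 * m) v ⊎ Ascends (suc i) m v

After : Endpoint ℕ JName → ℕ → Set
After (vertex u) v = v ≡ u
After (junc j s) v = Reach (junc j (not s)) v

after-pEnd : ∀ i j {v} → After (pEnd i j) v → Descends i j v
after-pEnd zero    j eq = j , eq , refl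
after-pEnd (suc i) j r  = r

reach-pEnd : ∀ i j {v} → Ascends i j v → Reach (pEnd i j) v
reach-pEnd zero    j (b , eq , l , n , f) = inj₂ (j , b , refl , eq , l , n , f refl)
reach-pEnd (suc i) j r = r

over-right : ∀ i j {v} → Descends i (suc j) v → Ascends i j v
over-right i j (b , eq , d) = b , eq , i , j , λ x → inj₁ (x , d)

over-left : ∀ i j {v} → Descends i j v → Ascends i (suc j) v
over-left i j (b , eq , d) = b , eq , i , j , λ x → inj₂ (x , d)

climb-left : ∀ i m {v} → Ascends (suc i) m v → Ascends i (3 * m) v
climb-left i m (b , eq , l , n , f) = b , eq , l , n , λ x → f (inj₁ x)

climb-right : ∀ i m {v} → Ascends (suc i) m v → Ascends i (suc (3 * m)) v
climb-right i m (b , eq , l , n , f) = b , eq , l , n , λ x → f (inj₂ x)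

reach-step : ∀ t s {v} → After (endT t (not s)) v → Reach (endT t s) v
reach-step (line t) false eq = inj₁ (inj₁ eq)
reach-step (line t) true  eq = inj₁ (inj₂ (cong suc (sym eq)))
reach-step (whole i j) false r = reach-pEnd i j (over-right i j (after-pEnd i (suc j) r))
reach-step (whole i j) true  r = reach-pEnd i (suc j) (over-left i j (after-pEnd i j r))
reach-step (arcL i m) false (inj₁ d) = reach-pEnd i (3 * m) (over-right i (3 * m) d)
reach-step (arcL i m) false (inj₂ u) = reach-pEnd i (3 * m) (climb-left i m u)
reach-step (arcL i m) true  r = after-pEnd i (3 * m) r
reach-step (arcM i m) false r = inj₁ r
reach-step (arcM i m) true  r = inj₁ r
reach-step (arcR i m) false r = after-pEnd i (suc (3 * m)) r
reach-step (arcR i m) true  (inj₁ d) = reach-pEnd i (suc (3 * m)) (over-left i (3 * m) d)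
reach-step (arcR i m) true  (inj₂ u) = reach-pEnd i (suc (3 * m)) (climb-right i m u)
reach-step (upL i m) false r = inj₂ r
reach-step (upL i m) true  (b , eq , d) = b , eq , inj₁ d
reach-step (upR i m) false r = inj₂ r
reach-step (upR i m) true  (b , eq , d) = b , eq , inj₂ d

trail⇒reach : ∀ {k p v} → Trail (drawingG k) p v → Reach p v
trail⇒reach {v = v} (stop ((t , _) , s) refl q) = reach-step t s (subst (λ e → After e v) (sym q) refl)
trail⇒reach {v = v} (go ((t , _) , s) j _ refl q tr) =
  reach-step t s (subst (λ e → After e v) (sym q) (trail⇒reach tr))

trail⇒edge : ∀ {k u v} → Trail (drawingG k) (vertex u) v → Edge u v
trail⇒edge = trail⇒reach

-- From arithmetic back to smooth curves.

∸-step : ∀ {i k} → i < k → k ∸ i ≡ suc (k ∸ suc i)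
∸-step {zero}  (s≤s _)   = refl
∸-step {suc i} (s≤s i<k) = ∸-step i<k

module _ {k : ℕ} where

  -- Tripling 2(j+1) < 3^(k-i-1) gives 2(3j+3) < 3^(k-i), enough for the semicircles starting at
  -- both points reached downwards from p_{i+1,j}.
  semi-child : ∀ {i j} → SemiOK k (suc i) j → SemiOK k i (3 * j) × SemiOK k i (suc (3 * j)) × Subdiv k i (3 * j)
  semi-child {i} {j} (i<k , le) =
    (i<k' , ≤-<-trans (*-monoʳ-≤ 2 (≤-trans (s≤s (n≤1+n _)) (s≤s (n≤1+n _)))) bound) ,
    (i<k' , ≤-<-trans (*-monoʳ-≤ 2 (s≤s (s≤s (n≤1+n _)))) bound) ,
    m∣m*n j , i<k
    where
    i<k' : i < k
    i<k' = <-trans (n<1+n i) i<k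
    shape : ∀ j → 2 * (3 + 3 * j) ≡ 3 * (2 * suc j)
    shape = solve-∀
    bound : 2 * (3 + 3 * j) < 3 ^ (k ∸ i)
    bound = subst₂ _<_ (sym (shape j)) (cong (3 ^_) (sym (∸-step i<k'))) (*-monoʳ-< 3 le)

  arrive : ∀ i {j b p} (d : Dart (drawingG k)) → start (drawingG k) d ≡ p →
           target (drawingG k) d ≡ pEnd i j → SemiOK k i j → Below i j b → Trail (drawingG k) p (2 * b)
  arrive zero d refl q ok refl = stop d refl q
  arrive (suc i) {j} d refl q ok b with semi-child {i} {j} ok
  ... | okL , okR , sub with b
  ...   | inj₁ b' = go d _ _ refl q (go ((upL i j , okL , sub) , true) _ _ refl refl
                      (arrive i ((arcL i j , okL , sub) , true) refl refl okL b'))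
  ...   | inj₂ b' = go d _ _ refl q (go ((upR i j , okL , sub) , true) _ _ refl refl
                      (arrive i ((arcR i j , okL , sub) , false) refl refl okR b'))

  ascend : ∀ i {j a v} → SemiOK k i j → Below i j a → Trail (drawingG k) (pEnd i j) v →
           Trail (drawingG k) (vertex (2 * a)) v
  ascend zero ok refl tr = tr
  ascend (suc i) {j} ok b tr with semi-child {i} {j} ok
  ... | okL , okR , sub with b
  ...   | inj₁ b' = ascend i okL b' (go ((arcL i j , okL , sub) , false) _ _ refl refl
                      (go ((upL i j , okL , sub) , false) _ _ refl refl tr))
  ...   | inj₂ b' = ascend i okR b' (go ((arcR i j , okL , sub) , true) _ _ refl refl
                      (go ((upR i j , okL , sub) , false) _ _ refl refl tr))

  traverse : ∀ l {n b} → SemiOK k l n → SemiOK k l (suc n) →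
    (Below l (suc n) b → Trail (drawingG k) (pEnd l n) (2 * b)) ×
    (Below l n b → Trail (drawingG k) (pEnd l (suc n)) (2 * b))
  traverse l {n} ok ok' with (3 ∣? n) ×-dec (suc l <? k)
  ... | no ¬sub = arrive l ((whole l n , ok , ¬sub) , false) refl refl ok' ,
                  arrive l ((whole l n , ok , ¬sub) , true) refl refl ok
  ... | yes (divides m eq , l<k) with refl ← trans eq (*-comm m 3) =
    (λ b → go ((arcL l m , ok , sub) , false) _ _ refl refl
      (go ((arcM l m , ok , sub) , false) _ _ refl refl
        (arrive l ((arcR l m , ok , sub) , false) refl refl ok' b))) ,
    (λ b → go ((arcR l m , ok , sub) , true) _ _ refl refl
      (go ((arcM l m , ok , sub) , true) _ _ refl refl
        (arrive l ((arcL l m , ok , sub) , true) refl refl ok b)))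
    where
    sub : Subdiv k l (3 * m)
    sub = m∣m*n m , l<k

  -- Semicircle (l,n+1) is what guarantees, through `semi-child`, the tracks descending from
  -- p_{l,n+1}.
  across⇒trail : ∀ {l n a b} → SemiOK k l n → SemiOK k l (suc n) → Across l n a b →
                 Trail (drawingG k) (vertex (2 * a)) (2 * b)
  across⇒trail {l} ok ok' (inj₁ (x , y)) = ascend l ok x (proj₁ (traverse l ok ok') y)
  across⇒trail {l} ok ok' (inj₂ (x , y)) = ascend l ok' x (proj₂ (traverse l ok ok') y)

  line⇒adjacent : ∀ {u v} → u < 3 ^ k → v < 3 ^ k → OnLine u v → Adjacent (drawingG k) u v
  line⇒adjacent _ v< (inj₁ refl) = (λ ()) , stop ((line _ , v<) , false) refl refl
  line⇒adjacent u< _ (inj₂ refl) = (λ ()) , stop ((line _ , u<) , true) refl refl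

-- Cuts and the path edges that leave them.

edge-endpoint : ∀ {u v u' v'} → OnLine u v → OnLine u' v' → Edge u' v → Edge u v' → OnLine u' v ⊎ OnLine u v'
edge-endpoint _ _ (inj₁ l) _ = inj₁ l
edge-endpoint _ _ (inj₂ _) (inj₁ l) = inj₂ l
-- Curves through semicircles join even-indexed vertices, so here both ends of the path edge `u`,
-- `v` would be even.
edge-endpoint (inj₁ p) _ (inj₂ (_ , b , _ , refl , _)) (inj₂ (a , _ , refl , _)) = ⊥-elim (even≢odd b a p)
edge-endpoint (inj₂ p) _ (inj₂ (_ , b , _ , refl , _)) (inj₂ (a , _ , refl , _)) = ⊥-elim (even≢odd a b p)

change : ∀ (f : ℕ → Bool) {i j} → i ≤ j → f i ≢ f j → ∃[ h ] i ≤ h × h < j × f h ≢ f (suc h)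
change f {i} {j} i≤j ne with m≤n⇒m<n∨m≡n i≤j
... | inj₂ refl = ⊥-elim (ne refl)
change f {i} {suc j} _ ne | inj₁ (s≤s i≤j) with f j Bool.≟ f (suc j)
... | no ne' = j , i≤j , ≤-refl , ne'
... | yes eq with h , i≤h , h<j , p ← change f i≤j (λ q → ne (trans q eq)) = h , i≤h , m<n⇒m<1+n h<j , p

Constant : Bool → (ℕ → Bool) → ℕ → ℕ → Set
Constant v f b ℓ = ∀ {h} → h < ℓ → f (b + h) ≡ v

constant? : ∀ v f b ℓ → Dec (Constant v f b ℓ)
constant? v f b = allUpTo? (λ h → f (b + h) Bool.≟ v)

exception : ∀ {v} f b ℓ → ¬ Constant v f b ℓ → ∃[ h ] h < ℓ × f (b + h) ≡ not v
exception {v} f b ℓ ¬c with anyUpTo? (λ h → f (b + h) Bool.≟ not v) ℓ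
... | yes p = p
... | no ¬p = ⊥-elim (¬c λ {h} h<ℓ → opposite λ eq → ¬p (h , h<ℓ , eq))
  where
  opposite : ∀ {x} → x ≢ not v → x ≡ v
  opposite ne = trans (¬-not ne) (not-involutive v)

module _ {k w : ℕ} where

  record Cut : Set where
    field
      mem     : ℕ → Bool
      col     : ℕ → Fin w
      uniform : ∀ {x x' y} → mem x ≡ true → mem x' ≡ true → mem y ≡ false → y < 3 ^ k →
                col x ≡ col x' → Adjacent (drawingG k) x y → Adjacent (drawingG k) x' y
  open Cut

  module _ (C : Cut) (b ℓ : ℕ) where

    record Switch : Set where
      field
        {inner outer} : ℕ
        inner≥ : b ≤ inner
        inner< : inner < b + ℓ
        outer≥ : b ≤ outer
        outer< : outer < b + ℓ
        inner∈ : mem C inner ≡ true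
        outer∉ : mem C outer ≡ false
        linked : OnLine inner outer

    switch : ¬ Constant true (mem C) b ℓ → ¬ Constant false (mem C) b ℓ → Switch
    switch ¬solid ¬hollow with exception (mem C) b ℓ ¬solid | exception (mem C) b ℓ ¬hollow
    ... | i , i<ℓ , eqᵢ | j , j<ℓ , eqⱼ = locate (≤-total i j)
      where
      orient : ∀ {h} → suc h < ℓ → mem C (b + h) ≢ mem C (suc (b + h)) → Switch
      orient {h} h<ℓ ne with mem C (b + h) in eq | mem C (suc (b + h)) in eq'
      ... | true  | true  = ⊥-elim (ne refl)
      ... | false | false = ⊥-elim (ne refl)
      ... | true  | false = record
        { inner≥ = m≤m+n b h ; inner< = +-monoʳ-< b (<-trans (n<1+n h) h<ℓ)
        ; outer≥ = ≤-trans (m≤m+n b h) (n≤1+n _) ; outer< = subst (_< b + ℓ) (+-suc b h) (+-monoʳ-< b h<ℓ)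
        ; inner∈ = eq ; outer∉ = eq' ; linked = inj₁ refl }
      ... | false | true  = record
        { outer≥ = m≤m+n b h ; outer< = +-monoʳ-< b (<-trans (n<1+n h) h<ℓ)
        ; inner≥ = ≤-trans (m≤m+n b h) (n≤1+n _) ; inner< = subst (_< b + ℓ) (+-suc b h) (+-monoʳ-< b h<ℓ)
        ; inner∈ = eq' ; outer∉ = eq ; linked = inj₂ refl }
      found : ∀ {i j} → i ≤ j → j < ℓ → mem C (b + i) ≢ mem C (b + j) → Switch
      found i≤j j<ℓ ne with change (λ h → mem C (b + h)) i≤j ne
      ... | h , _ , h<j , p = orient (≤-<-trans h<j j<ℓ) (subst (λ z → mem C (b + h) ≢ mem C z) (+-suc b h) p)
      locate : i ≤ j ⊎ j ≤ i → Switch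
      locate (inj₁ i≤j) = found i≤j j<ℓ (λ eq → not-¬ (trans (sym eqᵢ) (trans eq eqⱼ)) refl)
      locate (inj₂ j≤i) = found j≤i i<ℓ (λ eq → not-¬ (trans (sym eqⱼ) (trans eq eqᵢ)) refl)

  open Switch

  -- Equal colours allow the inner ends to be exchanged. By `edge-endpoint` one of the two resulting
  -- edges is a path edge, but points of the two intervals differ by at least 2.
  switches-conflict : ∀ (C : Cut) {b b' ℓ} → b + ℓ < b' → b' + ℓ ≤ 3 ^ k →
    (s : Switch C b ℓ) (s' : Switch C b' ℓ) → col C (inner s) ≡ col C (inner s') → ⊥
  switches-conflict C {b} {b'} {ℓ} gap fits s s' same
    with edge-endpoint (linked s) (linked s')
           (trail⇒edge (proj₂ (uniform C (inner∈ s) (inner∈ s') (outer∉ s) (below' (outer< s)) same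
              (line⇒adjacent (below' (inner< s)) (below' (outer< s)) (linked s)))))
           (trail⇒edge (proj₂ (uniform C (inner∈ s') (inner∈ s) (outer∉ s') (below (outer< s')) (sym same)
              (line⇒adjacent (below (inner< s')) (below (outer< s')) (linked s')))))
    where
    below : ∀ {x} → x < b' + ℓ → x < 3 ^ k
    below x< = <-≤-trans x< fits
    below' : ∀ {x} → x < b + ℓ → x < 3 ^ k
    below' x< = below (<-trans x< (<-≤-trans gap (m≤m+n b' ℓ)))
  ... | inj₁ (inj₁ refl) = 1+n≰n (≤-trans (s≤s (inner≥ s')) (≤-trans (<⇒≤ (outer< s)) (<⇒≤ gap)))
  ... | inj₁ (inj₂ eq) = 1+n≰n (≤-trans (s≤s (≤-trans (inner≥ s') (≤-reflexive eq))) (≤-trans (s≤s (outer< s)) gap))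
  ... | inj₂ (inj₁ eq) = 1+n≰n (≤-trans (s≤s (≤-trans (outer≥ s') (≤-reflexive eq))) (≤-trans (s≤s (inner< s)) gap))
  ... | inj₂ (inj₂ refl) = 1+n≰n (≤-trans (s≤s (outer≥ s')) (≤-trans (<⇒≤ (inner< s)) (<⇒≤ gap)))

  -- Cuts obtained from subexpressions.

  -- later c d: some operation above e joins the vertices that have colours c and d in e.
  record Embedded {n} (e : Expr w n) (ι : Fin n → ℕ) : Set₁ where
    field
      later   : Fin w → Fin w → Set
      inside  : ∀ x y → Adjacent (drawingG k) (ι x) (ι y) ⇔ (Adj e x y ⊎ later (colour e x) (colour e y))
      outside : ∀ {x x' y} → y < 3 ^ k → (∀ z → ι z ≢ y) → colour e x ≡ colour e x' →
                Adjacent (drawingG k) (ι x) y → Adjacent (drawingG k) (ι x') y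
  open Embedded
  open Equivalence

  image? : ∀ {n} (ι : Fin n → ℕ) y → Dec (∃[ x ] ι x ≡ y)
  image? ι y = any? (λ x → ι x ≟ y)

  image : ∀ {n} → (Fin n → ℕ) → ℕ → Bool
  image ι y = does (image? ι y)

  image⇒preimage : ∀ {n} (ι : Fin n → ℕ) {y} → image ι y ≡ true → ∃[ x ] ι x ≡ y
  image⇒preimage ι {y} eq with image? ι y
  ... | yes p = p

  someColour : ∀ {n} → Expr w n → Fin w
  someColour (single a)      = a
  someColour (union e f)     = someColour e
  someColour (recolor a b e) = a
  someColour (join a b _ e)  = a

  cut : ∀ {n} (e : Expr w n) (ι : Fin n → ℕ) → Embedded e ι → Cut
  cut e ι E = record { mem = image ι ; col = col′ ; uniform = uniform′ }
    where
    col′ : ℕ → Fin w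
    col′ y with image? ι y
    ... | yes (x , _) = colour e x
    -- A default value: `uniform′` compares the colours of members only.
    ... | no _        = someColour e
    uniform′ : ∀ {x x' y} → image ι x ≡ true → image ι x' ≡ true → image ι y ≡ false → y < 3 ^ k →
               col′ x ≡ col′ x' → Adjacent (drawingG k) x y → Adjacent (drawingG k) x' y
    uniform′ {x} {x'} {y} _ _ _ y< same adj with image? ι x | image? ι x' | image? ι y
    ... | yes (_ , refl) | yes (_ , refl) | no y∉ = outside E y< (λ z eq → y∉ (z , eq)) same adj

  -- Later operations see the recoloured labels, so `later` is precomposed with `ρ`.
  recolor-child : ∀ {n a b} {e : Expr w n} {ι} → Embedded (recolor a b e) ι → Embedded e ι
  recolor-child {a = a} {b} E = record
    { later = λ c d → later E (ρ c) (ρ d) ; inside = inside E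
    ; outside = λ y< y∉ same → outside E y< y∉ (cong ρ same) }
    where
    ρ : Fin w → Fin w
    ρ c = if does (c Fin.≟ a) then b else c

  join-child : ∀ {n a b a≢b} {e : Expr w n} {ι} → Embedded (join a b a≢b e) ι → Embedded e ι
  join-child {a = a} {b} E = record
    { later = λ c d → ((c ≡ a × d ≡ b) ⊎ (c ≡ b × d ≡ a)) ⊎ later E c d
    ; inside = λ x y → mk⇔ (Sum.assocʳ ∘ to (inside E x y)) (from (inside E x y) ∘ Sum.assocˡ)
    ; outside = outside E }

  -- A union adds no edges between its operands, so those edges come from later operations and
  -- depend on colours alone. A vertex outside `e` lies either in `f` or outside the whole union.
  union-left : ∀ {m n} {e : Expr w m} {f : Expr w n} {ι} → Embedded (union e f) ι → Embedded e (ι ∘ (_↑ˡ n))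
  union-left {m} {n} {e} {f} {ι} E = record { later = later E ; inside = inside′ ; outside = outside′ }
    where
    inside′ : ∀ x y → Adjacent (drawingG k) (ι (x ↑ˡ n)) (ι (y ↑ˡ n)) ⇔ (Adj e x y ⊎ later E (colour e x) (colour e y))
    inside′ x y with inside E (x ↑ˡ n) (y ↑ˡ n)
    ... | iff rewrite splitAt-↑ˡ m x n | splitAt-↑ˡ m y n = iff
    colour-left : ∀ x → colour (union e f) (x ↑ˡ n) ≡ colour e x
    colour-left x rewrite splitAt-↑ˡ m x n = refl
    mixed : ∀ x z → Adjacent (drawingG k) (ι (x ↑ˡ n)) (ι (m ↑ʳ z)) ⇔ later E (colour e x) (colour f z)
    mixed x z with inside E (x ↑ˡ n) (m ↑ʳ z)
    ... | iff rewrite splitAt-↑ˡ m x n | splitAt-↑ʳ m n z = mk⇔ (λ h → [ ⊥-elim , id ]′ (to iff h)) (from iff ∘ inj₂)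
    outside′ : ∀ {x x' y} → y < 3 ^ k → (∀ z → ι (z ↑ˡ n) ≢ y) → colour e x ≡ colour e x' →
               Adjacent (drawingG k) (ι (x ↑ˡ n)) y → Adjacent (drawingG k) (ι (x' ↑ˡ n)) y
    outside′ {x} {x'} {y} y< y∉ same adj with image? (ι ∘ (m ↑ʳ_)) y
    ... | yes (z , refl) = from (mixed x' z) (subst (λ c → later E c (colour f z)) same (to (mixed x z) adj))
    ... | no y∉ʳ = outside E y< y∉′ (trans (colour-left x) (trans same (sym (colour-left x')))) adj
      where
      y∉′ : ∀ z → ι z ≢ y
      y∉′ z eq with splitAt m z | join-splitAt m n z
      ... | inj₁ z' | refl = y∉ z' eq
      ... | inj₂ z' | refl = y∉ʳ (z' , eq)

  union-right : ∀ {m n} {e : Expr w m} {f : Expr w n} {ι} → Embedded (union e f) ι → Embedded f (ι ∘ (m ↑ʳ_))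
  union-right {m} {n} {e} {f} {ι} E = record { later = later E ; inside = inside′ ; outside = outside′ }
    where
    inside′ : ∀ x y → Adjacent (drawingG k) (ι (m ↑ʳ x)) (ι (m ↑ʳ y)) ⇔ (Adj f x y ⊎ later E (colour f x) (colour f y))
    inside′ x y with inside E (m ↑ʳ x) (m ↑ʳ y)
    ... | iff rewrite splitAt-↑ʳ m n x | splitAt-↑ʳ m n y = iff
    colour-right : ∀ x → colour (union e f) (m ↑ʳ x) ≡ colour f x
    colour-right x rewrite splitAt-↑ʳ m n x = refl
    mixed : ∀ x z → Adjacent (drawingG k) (ι (m ↑ʳ x)) (ι (z ↑ˡ n)) ⇔ later E (colour f x) (colour e z)
    mixed x z with inside E (m ↑ʳ x) (z ↑ˡ n)
    ... | iff rewrite splitAt-↑ʳ m n x | splitAt-↑ˡ m z n = mk⇔ (λ h → [ ⊥-elim , id ]′ (to iff h)) (from iff ∘ inj₂)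
    outside′ : ∀ {x x' y} → y < 3 ^ k → (∀ z → ι (m ↑ʳ z) ≢ y) → colour f x ≡ colour f x' →
               Adjacent (drawingG k) (ι (m ↑ʳ x)) y → Adjacent (drawingG k) (ι (m ↑ʳ x')) y
    outside′ {x} {x'} {y} y< y∉ same adj with image? (ι ∘ (_↑ˡ n)) y
    ... | yes (z , refl) = from (mixed x' z) (subst (λ c → later E c (colour e z)) same (to (mixed x z) adj))
    ... | no y∉ˡ = outside E y< y∉′ (trans (colour-right x) (trans same (sym (colour-right x')))) adj
      where
      y∉′ : ∀ z → ι z ≢ y
      y∉′ z eq with splitAt m z | join-splitAt m n z
      ... | inj₁ z' | refl = y∉ˡ (z' , eq)
      ... | inj₂ z' | refl = y∉ z' eq

  -- A cut containing one segment and missing another.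

  module _ {S : ℕ} (base : Fin S → ℕ) {ℓ : ℕ} (2≤ℓ : 2 ≤ ℓ) where

    Solid Hollow : (ℕ → Bool) → Fin S → Set
    Solid  f s = Constant true f (base s) ℓ
    Hollow f s = Constant false f (base s) ℓ

    solid? : ∀ f → Dec (∃ (Solid f))
    solid? f = any? (λ s → constant? true f (base s) ℓ)

    image-union : ∀ {m n} (ι : Fin (m + n) → ℕ) {y} → image ι y ≡ true → image (ι ∘ (_↑ˡ n)) y ≡ false →
                  image (ι ∘ (m ↑ʳ_)) y ≡ true
    image-union {m} {n} ι {y} y∈ y∉ with image? ι y | image? (ι ∘ (_↑ˡ n)) y | image? (ι ∘ (m ↑ʳ_)) y
    ... | _ | _ | yes _ = refl
    ... | yes (x , eq) | no y∉ˡ | no y∉ʳ with splitAt m x | join-splitAt m n x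
    ...   | inj₁ z | refl = ⊥-elim (y∉ˡ (z , eq))
    ...   | inj₂ z | refl = ⊥-elim (y∉ʳ (z , eq))

    -- C₀ is the left child of a minimal subexpression containing a whole segment.
    minimal : ∀ {n} (e : Expr w n) (ι : Fin n → ℕ) → Embedded e ι → ∃ (Solid (image ι)) →
      Σ[ C ∈ Cut ] Σ[ C₀ ∈ Cut ] ∃ (Solid (mem C)) ×
        (∀ s → Solid (mem C) s → ¬ Solid (mem C₀) s × ¬ Hollow (mem C₀) s)
    minimal (single a) ι E (s , solid)
      with image⇒preimage ι (solid 2≤ℓ) | image⇒preimage ι (solid (<-trans (s≤s z≤n) 2≤ℓ))
    -- A segment has at least two points, so one vertex cannot fill it.
    ... | Fin.zero , eq₁ | Fin.zero , eq₀ = ⊥-elim (1+n≢n (+-cancelˡ-≡ (base s) 1 0 (trans (sym eq₁) eq₀)))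
    minimal (recolor a b e) ι E = minimal e ι (recolor-child E)
    minimal (join a b _ e)  ι E = minimal e ι (join-child E)
    minimal (union {m} {n} e f) ι E (s , solid) with solid? (image (ι ∘ (_↑ˡ n))) | solid? (image (ι ∘ (m ↑ʳ_)))
    ... | yes p | _ = minimal e _ (union-left E) p
    ... | no _ | yes p = minimal f _ (union-right E) p
    -- If the left operand missed a segment of the union, the right operand would contain that
    -- segment.
    ... | no ¬l | no ¬r = cut (union e f) ι E , cut e _ (union-left E) , (s , solid) ,
      λ s' solid' → (λ p → ¬l (s' , p)) , λ hollow → ¬r (s' , λ h → image-union {m} {n} ι (solid' h) (hollow h))

  module _ (base : Fin (suc (w + w)) → ℕ) {ℓ : ℕ} (2≤ℓ : 2 ≤ ℓ)
    (gap : ∀ {i j} → i Fin.< j → base i + ℓ < base j) (fits : ∀ s → base s + ℓ ≤ 3 ^ k) where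

    -- If `C` meets every segment, then each is split by `C`, or is contained in `C` and split by
    -- `C₀`. The 2w+1 segments outnumber the 2w pairs of a cut and a colour.
    separating : ∀ {n} (e : Expr w n) (ι : Fin n → ℕ) → Embedded e ι → (∀ {y} → y < 3 ^ k → image ι y ≡ true) →
      Σ[ C ∈ Cut ] ∃ (Solid base 2≤ℓ (mem C)) × ∃ (Hollow base 2≤ℓ (mem C))
    separating e ι E onto
      with minimal base 2≤ℓ e ι E (Fin.zero , λ h<ℓ → onto (<-≤-trans (+-monoʳ-< (base Fin.zero) h<ℓ) (fits Fin.zero)))
    ... | C , C₀ , solid , minimality with any? (λ s → constant? false (mem C) (base s) ℓ)
    ...   | yes hollow = C , solid , hollow
    ...   | no ¬hollow = ⊥-elim absurd
      where
      Mixed : Fin (suc (w + w)) → Set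
      Mixed s = Switch C (base s) ℓ ⊎ Switch C₀ (base s) ℓ
      mixed : ∀ s → Mixed s
      mixed s with constant? true (mem C) (base s) ℓ
      ... | yes p = inj₂ (switch C₀ (base s) ℓ (proj₁ (minimality s p)) (proj₂ (minimality s p)))
      ... | no ¬p = inj₁ (switch C (base s) ℓ ¬p (λ h → ¬hollow (s , h)))
      key : ∀ {s} → Mixed s → Fin w ⊎ Fin w
      key = Sum.map (col C ∘ inner) (col C₀ ∘ inner)
      conflict : ∀ {i j} → i Fin.< j → (p : Mixed i) (q : Mixed j) → key p ≡ key q → ⊥
      conflict {i} {j} i<j (inj₁ p) (inj₁ q) eq = switches-conflict C (gap i<j) (fits j) p q (inj₁-injective eq)
      conflict {i} {j} i<j (inj₂ p) (inj₂ q) eq = switches-conflict C₀ (gap i<j) (fits j) p q (inj₂-injective eq)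
      absurd : ⊥
      absurd with pigeonhole ≤-refl (Fin.join w w ∘ key ∘ mixed)
      ... | i , j , i<j , eq = conflict i<j (mixed i) (mixed j)
        (trans (sym (splitAt-join w w _)) (trans (cong (splitAt w) eq) (splitAt-join w w _)))

-- Edges of limited level and distant representatives.

Far : ℕ → ℕ → ℕ → Set
Far μ a b = a + 2 * 3 ^ μ ≤ b ⊎ b + 2 * 3 ^ μ ≤ a

far? : ∀ μ a b → Dec (Far μ a b)
far? μ a b = (a + 2 * 3 ^ μ ≤? b) ⊎-dec (b + 2 * 3 ^ μ ≤? a)

-- Some ternary digit of a below position μ is 2, so that v_{2a} has edges through levels < μ only.
Limited : ℕ → ℕ → Set
Limited μ a = ∀ m → ¬ Below μ m a

limited-mono : ∀ {μ μ' a} → μ ≤ μ' → Limited μ a → Limited μ' a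
limited-mono {μ} {μ'} μ≤μ' lim m b with below-antitone {μ'} μ≤μ' b
... | m' , b' = lim m' b'

across-lower : ∀ {l n a b} → Across l n a b → n * 3 ^ l ≤ a
across-lower {l} (inj₁ (x , _)) = below-lower l x
across-lower {l} {n} (inj₂ (x , _)) = ≤-trans (*-monoˡ-≤ (3 ^ l) (n≤1+n n)) (below-lower l x)

across-upper : ∀ {l n a b} → Across l n a b → a < (2 + n) * 3 ^ l
across-upper {l} {n} (inj₁ (x , _)) = <-≤-trans (below-upper l x) (*-monoˡ-≤ (3 ^ l) (n≤1+n (suc n)))
across-upper {l} (inj₂ (x , _)) = below-upper l x

across-low : ∀ {l n a b μ} → Across l n a b → Limited μ a → l < μ
across-low {l} {μ = μ} ac lim with l <? μ
... | yes l<μ = l<μ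
... | no l≮μ = ⊥-elim (outer ac)
  where
  refute : ∀ {n} → Below l n _ → ⊥
  refute b with below-antitone {l} (≮⇒≥ l≮μ) b
  ... | m , b' = lim m b'
  outer : Across l _ _ _ → ⊥
  outer (inj₁ (x , _)) = refute x
  outer (inj₂ (x , _)) = refute x

-- Both ends lie in two neighbouring blocks of length 3^l, which together span only 2·3^l.
across-near : ∀ {l n a b μ} → Across l n a b → l < μ → ¬ (a + 2 * 3 ^ μ ≤ b)
across-near {l} {n} {a} {b} {μ} ac l<μ far = <⇒≱ (begin-strict
  b                       <⟨ across-upper (across-sym ac) ⟩
  (2 + n) * 3 ^ l         ≡⟨ split n (3 ^ l) ⟩
  n * 3 ^ l + 2 * 3 ^ l   ≤⟨ +-mono-≤ (across-lower ac) (*-monoʳ-≤ 2 (^-monoʳ-≤ 3 (<⇒≤ l<μ))) ⟩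
  a + 2 * 3 ^ μ           ∎) far
  where
  open ≤-Reasoning
  split : ∀ n x → (2 + n) * x ≡ n * x + 2 * x
  split = solve-∀

-- Both ends of an edge descend from the same level, so either limited end keeps that level below
-- `μ`.
far⇒¬edge : ∀ {μ a b} → Limited μ a ⊎ Limited μ b → Far μ a b → ¬ Edge (2 * a) (2 * b)
far⇒¬edge {a = a} {b} _ _ (inj₁ (inj₁ eq)) = even≢odd b a eq
far⇒¬edge {a = a} {b} _ _ (inj₁ (inj₂ eq)) = even≢odd a b eq
far⇒¬edge {μ} {a} {b} lim far (inj₂ (a' , b' , eqᵃ , eqᵇ , l , n , ac))
  with refl ← *-cancelˡ-≡ a a' 2 eqᵃ | refl ← *-cancelˡ-≡ b b' 2 eqᵇ = refute far
  where
  low : Limited μ a ⊎ Limited μ b → l < μ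
  low (inj₁ p) = across-low ac p
  low (inj₂ p) = across-low (across-sym ac) p
  refute : Far μ a b → ⊥
  refute (inj₁ p) = across-near {μ = μ} ac (low lim) p
  refute (inj₂ p) = across-near {μ = μ} (across-sym ac) (low lim) p

-- Colouring each block by its representative turns the line into a sequence of bits in which a
-- change can be sought.
Rep : (i : ℕ) → (ℕ → Set) → Set
Rep i Φ = ∀ j → ∃[ a ] Below i j a × Φ a

FarFrom : ∀ {m} → ℕ → (Fin m → ℕ) → ℕ → Set
FarFrom μ F a = ∀ c → Far μ a (F c)

-- The points j·3^i + 3^g with g > μ are so spread out that each value of F is close to at most
-- one of them.
far-rep : ∀ {m} μ (F : Fin m → ℕ) i → μ + m + 2 ≤ i → Rep i (FarFrom μ F)
far-rep {m} μ F i room j = decide (any? (λ c → all? (λ f → far? μ (r c) (F f))))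
  where
  r : Fin (suc m) → ℕ
  r c = j * 3 ^ i + 3 ^ (suc μ + toℕ c)
  power< : ∀ c → suc μ + toℕ c < i
  power< c = ≤-trans (s≤s (s≤s (+-monoʳ-≤ μ (≤-pred (toℕ<n c))))) (≤-trans (≤-reflexive (+-comm 2 (μ + m))) room)
  spread : ∀ {c c'} → c Fin.< c' → r c + 2 * 3 ^ μ + 2 * 3 ^ μ ≤ r c'
  spread {c} {c'} c<c' = begin
    r c + 2 * 3 ^ μ + 2 * 3 ^ μ   ≡⟨ shape (j * 3 ^ i) (3 ^ (suc μ + toℕ c)) (3 ^ μ) ⟩
    j * 3 ^ i + (3 ^ (suc μ + toℕ c) + 4 * 3 ^ μ) ≤⟨ +-monoʳ-≤ (j * 3 ^ i) (+-monoʳ-≤ (3 ^ (suc μ + toℕ c)) four) ⟩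
    j * 3 ^ i + 3 ^ suc (suc μ + toℕ c) ≤⟨ +-monoʳ-≤ (j * 3 ^ i) (^-monoʳ-≤ 3 (s≤s
                                             (≤-trans (≤-reflexive (sym (+-suc μ _))) (+-monoʳ-≤ μ c<c')))) ⟩
    r c' ∎
    where
    open ≤-Reasoning
    shape : ∀ x y z → x + y + 2 * z + 2 * z ≡ x + (y + 4 * z)
    shape = solve-∀
    six : ∀ x → 4 * x + 2 * x ≡ 2 * (3 * x)
    six = solve-∀
    -- The exponent is at least μ+1, so the right side is at least 6·3^μ.
    four : 4 * 3 ^ μ ≤ 2 * 3 ^ (suc μ + toℕ c)
    four = ≤-trans (m≤m+n _ (2 * 3 ^ μ)) (≤-trans (≤-reflexive (six (3 ^ μ)))
             (*-monoʳ-≤ 2 (^-monoʳ-≤ 3 (m≤m+n (suc μ) (toℕ c)))))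
  decide : Dec (∃[ c ] FarFrom μ F (r c)) → ∃[ a ] Below i j a × FarFrom μ F a
  decide (yes (c , far)) = r c , below-power i j (power< c) , far
  -- Each of the m+1 candidates is near one of the m values of `F`. Two candidates near the same
  -- value would be less than 4·3^μ apart, against `spread`.
  decide (no ¬far) = ⊥-elim (<⇒≱
    (<-trans (≰⇒> (proj₂ (killer c') ∘ inj₂)) (+-monoˡ-< (2 * 3 ^ μ) (≰⇒> (near ∘ inj₁))))
    (spread c<c'))
    where
    killer : ∀ c → ∃[ f ] ¬ Far μ (r c) (F f)
    killer c = ¬∀⟶∃¬ m _ (λ f → far? μ (r c) (F f)) (λ far → ¬far (c , far))
    clash : ∃₂ λ c c' → c Fin.< c' × proj₁ (killer c) ≡ proj₁ (killer c')
    clash = pigeonhole ≤-refl (proj₁ ∘ killer)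
    c c' : Fin (suc m)
    c  = proj₁ clash
    c' = proj₁ (proj₂ clash)
    c<c' : c Fin.< c'
    c<c' = proj₁ (proj₂ (proj₂ clash))
    near : ¬ Far μ (r c) (F (proj₁ (killer c')))
    near = subst (λ f → ¬ Far μ (r c) (F f)) (proj₂ (proj₂ (proj₂ clash))) (proj₂ (killer c))

-- Bichromatic edges at every scale.

data Mod₃ : ℕ → Set where
  r₀ : ∀ m → Mod₃ (3 * m)
  r₁ : ∀ m → Mod₃ (1 + 3 * m)
  r₂ : ∀ m → Mod₃ (2 + 3 * m)

3*suc : ∀ m → 3 * suc m ≡ 3 + 3 * m
3*suc = solve-∀

mod₃ : ∀ j → Mod₃ j
mod₃ zero = r₀ 0
mod₃ (suc j) with mod₃ j
... | r₀ m = r₁ m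
... | r₁ m = r₂ m
... | r₂ m = subst Mod₃ (3*suc m) (r₀ (suc m))

%₃ : ∀ r m → (r + 3 * m) % 3 ≡ r % 3
%₃ r m = trans (cong (λ x → (r + x) % 3) (*-comm 3 m)) ([m+kn]%n≡m%n r m 3)

-- Curves reach a point of level i+1 only from points of level `i` with index 0 or 1 modulo 3.
digit₂-limited : ∀ i {m a} → Below i (2 + 3 * m) a → Limited (suc i) a
digit₂-limited i {m} b m' (inj₁ b') with () ← trans (sym (%₃ 2 m)) (trans (cong (_% 3) (below-unique i b b')) (%₃ 0 m'))
digit₂-limited i {m} b m' (inj₂ b') with () ← trans (sym (%₃ 2 m)) (trans (cong (_% 3) (below-unique i b b')) (%₃ 1 m'))

-- The digit 2 may sit at position i+1, whence `2 + i`. The field `bounded` serves to show that the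
-- semicircles used exist in the drawing.
record Crossing (χ : ℕ → Bool) (Φ : ℕ → Set) (i bound : ℕ) : Set where
  field
    {u v l n} : ℕ
    across    : Across l n u v
    differ    : χ u ≢ χ v
    limited   : Limited (2 + i) u ⊎ Limited (2 + i) v
    Φu        : Φ u
    Φv        : Φ v
    level≤    : l ≤ suc i
    bounded   : (2 + n) * 3 ^ l ≤ bound

-- If neither end of a bichromatic edge between blocks j and j+1 has a digit 2 at position i or
-- i+1, then j ends in 0, and the block ⌊j/3⌋ of level i+1, which contains both ends, is adjacent
-- to one whose index does end in 2.  A representative of the latter is joined to both ends and
-- differs in colour from one of them.
crossing : ∀ (χ : ℕ → Bool) (Φ : ℕ → Set) i (rep : Rep i Φ) (rep′ : Rep (suc i) Φ) j → 1 ≤ j →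
  χ (proj₁ (rep j)) ≢ χ (proj₁ (rep (suc j))) → Crossing χ Φ i ((6 + j) * 3 ^ i)
crossing χ Φ i rep rep′ j 1≤j ne with rep j | rep (suc j)
... | u , bu , Φu | v , bv , Φv = cases (mod₃ j) 1≤j bu bv ≤-refl
  where
  direct : ∀ {j'} → Below i j' u → Below i (suc j') v → j' ≤ j → Limited (2 + i) u ⊎ Limited (2 + i) v →
           Crossing χ Φ i ((6 + j) * 3 ^ i)
  direct bu bv j'≤j lim = record { across = inj₁ (bu , bv) ; differ = ne ; limited = lim ; Φu = Φu ; Φv = Φv
    ; level≤ = n≤1+n i ; bounded = *-monoˡ-≤ (3 ^ i) (≤-trans (+-monoʳ-≤ 2 j'≤j) (m≤n+m (2 + j) 4)) }
  via : ∀ n → (z : ∃[ z ] Limited (2 + i) z × Φ z × Across (suc i) n z u × Across (suc i) n z v) → 3 * n ≤ j →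
        Crossing χ Φ i ((6 + j) * 3 ^ i)
  via n (z , lim , Φz , zu , zv) n≤ = pick (χ z Bool.≟ χ u)
    where
    shape : ∀ n x → (2 + n) * (3 * x) ≡ (6 + 3 * n) * x
    shape = solve-∀
    bd : (2 + n) * 3 ^ suc i ≤ (6 + j) * 3 ^ i
    bd = ≤-trans (≤-reflexive (shape n (3 ^ i))) (*-monoˡ-≤ (3 ^ i) (+-monoʳ-≤ 6 n≤))
    pick : Dec (χ z ≡ χ u) → Crossing χ Φ i ((6 + j) * 3 ^ i)
    pick (no ne′) = record { across = zu ; differ = ne′ ; limited = inj₁ lim
                             ; Φu = Φz ; Φv = Φu ; level≤ = ≤-refl ; bounded = bd }
    pick (yes eq) = record { across = zv ; differ = λ eq′ → ne (trans (sym eq) eq′) ; limited = inj₁ lim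
                             ; Φu = Φz ; Φv = Φv ; level≤ = ≤-refl ; bounded = bd }
  cases : ∀ {j'} → Mod₃ j' → 1 ≤ j' → Below i j' u → Below i (suc j') v → j' ≤ j → Crossing χ Φ i ((6 + j) * 3 ^ i)
  cases (r₁ m) _ bu bv le = direct bu bv le (inj₂ (limited-mono (n≤1+n _) (digit₂-limited i {m} bv)))
  cases (r₂ m) _ bu bv le = direct bu bv le (inj₁ (limited-mono (n≤1+n _) (digit₂-limited i {m} bu)))
  cases (r₀ D) 1≤ bu bv le with mod₃ D
  ... | r₂ E = direct bu bv le (inj₁ (digit₂-limited (suc i) {E} (inj₁ bu)))
  ... | r₁ E with rep′ (2 + 3 * E)
  ...   | z , bz , Φz = via (1 + 3 * E) (z , digit₂-limited (suc i) {E} bz , Φz , inj₂ (bz , inj₁ bu) , inj₂ (bz , inj₂ bv)) le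
  -- Block 0 has no left neighbour; this is where `1 ≤ j` enters.
  cases (r₀ D) () bu bv le | r₀ zero
  cases (r₀ D) 1≤ bu bv le | r₀ (suc E) with rep′ (2 + 3 * E)
  ... | z , bz , Φz = via (2 + 3 * E) (z , digit₂-limited (suc i) {E} bz , Φz , inj₁ (bz , up (inj₁ bu)) , inj₁ (bz , up (inj₂ bv)))
          (≤-trans (*-monoʳ-≤ 3 (≤-trans (n≤1+n _) (≤-reflexive (sym (3*suc E))))) le)
    where
    up : ∀ {a} → Below (suc i) (3 * suc E) a → Below (suc i) (3 + 3 * E) a
    up {a} = subst (λ x → Below (suc i) x a) (3*suc E)

-- Links with pairwise distinct colours.

^-∸-* : ∀ b {m n} → m ≤ n → b ^ (n ∸ m) * b ^ m ≡ b ^ n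
^-∸-* b {m} {n} m≤n = trans (sym (^-distribˡ-+-* b (n ∸ m) m)) (cong (b ^_) (m∸n+n≡m m≤n))

semi-bounded : ∀ {k l n X} → l < k → suc n * 3 ^ l ≤ X → 2 * X < 3 ^ k → SemiOK k l n
semi-bounded {k} {l} {n} {X} l<k le lt = l<k , *-cancelʳ-< (3 ^ l) (2 * suc n) (3 ^ (k ∸ l)) (begin-strict
  2 * suc n * 3 ^ l         ≡⟨ *-assoc 2 (suc n) (3 ^ l) ⟩
  2 * (suc n * 3 ^ l)       ≤⟨ *-monoʳ-≤ 2 le ⟩
  2 * X                     <⟨ lt ⟩
  3 ^ k                     ≡⟨ ^-∸-* 3 (<⇒≤ l<k) ⟨
  3 ^ (k ∸ l) * 3 ^ l       ∎)
  where open ≤-Reasoning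

-- Scale bounding the first n links; the step leaves room for the 2n+1 candidates of far-rep.
level : ℕ → ℕ
level zero    = 0
level (suc n) = 2 + (level n + (n + n) + 2)

level-step : ∀ n → level n ≤ level (suc n)
level-step n = ≤-trans (≤-trans (m≤m+n (level n) (n + n)) (m≤m+n _ 2)) (≤-trans (n≤1+n _) (n≤1+n _))

module _ {k w : ℕ} (C : Cut {k} {w}) (K B : ℕ) (K<k : K < k) (room : 2 * (B * 3 ^ K) < 3 ^ k) where
  open Cut C

  record Link (μ : ℕ) : Set where
    field
      x y      : ℕ
      x∈       : mem (2 * x) ≡ true
      y∉       : mem (2 * y) ≡ false
      y<       : 2 * y < 3 ^ k
      adjacent : Adjacent (drawingG k) (2 * x) (2 * y)
      limited  : Limited μ x ⊎ Limited μ y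
  open Link

  weaken : ∀ {μ μ'} → μ ≤ μ' → Link μ → Link μ'
  weaken le L = record { x∈ = x∈ L ; y∉ = y∉ L ; y< = y< L ; adjacent = adjacent L
                       ; limited = Sum.map (limited-mono le) (limited-mono le) (limited L) }

  -- Equal colours would let the ends inside the cut be exchanged. One of the new edges joins the
  -- limited end of `L` to a far end of `L'`.
  far⇒distinct : ∀ {μ μ'} (L : Link μ) (L' : Link μ') → Far μ (x L') (y L) → Far μ (y L') (x L) →
                 col (2 * x L') ≢ col (2 * x L)
  far⇒distinct {μ} L L' farˣ farʸ same with limited L
  ... | inj₁ lim = far⇒¬edge {μ} (inj₁ lim) (swap farʸ)
    (trail⇒edge (proj₂ (uniform (x∈ L') (x∈ L) (y∉ L') (y< L') same (adjacent L'))))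
  ... | inj₂ lim = far⇒¬edge {μ} (inj₂ lim) farˣ
    (trail⇒edge (proj₂ (uniform (x∈ L) (x∈ L') (y∉ L) (y< L) (sym same) (adjacent L))))

  orient : ∀ {Φ i} → suc i ≤ K → Crossing (λ a → mem (2 * a)) Φ i (B * 3 ^ K) →
           Σ[ L ∈ Link (2 + i) ] Φ (x L) × Φ (y L)
  orient {Φ} {i} i<K X = choose (mem (2 * u) Bool.≟ true)
    where
    open Crossing X hiding (limited)
    l<k : l < k
    l<k = ≤-<-trans level≤ (≤-<-trans i<K K<k)
    ok : SemiOK k l n
    ok = semi-bounded l<k (≤-trans (*-monoˡ-≤ (3 ^ l) (n≤1+n (suc n))) bounded) room
    ok′ : SemiOK k l (suc n)
    ok′ = semi-bounded l<k bounded room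
    fits : ∀ {a b} → Across l n a b → 2 * a < 3 ^ k
    fits ac = <-trans (*-monoʳ-< 2 (<-≤-trans (across-upper ac) bounded)) room
    choose : Dec (mem (2 * u) ≡ true) → Σ[ L ∈ Link (2 + i) ] Φ (x L) × Φ (y L)
    choose (yes u∈) = record { x = u ; y = v ; x∈ = u∈ ; y∉ = ¬-not (λ v∈ → differ (trans u∈ (sym v∈)))
      ; y< = fits (across-sym across) ; adjacent = (λ eq → differ (cong mem eq)) , across⇒trail ok ok′ across
      ; limited = Crossing.limited X } , Φu , Φv
    choose (no u∉) = record { x = v ; y = u ; x∈ = trans (¬-not (differ ∘ sym)) (cong not (¬-not u∉)) ; y∉ = ¬-not u∉
      ; y< = fits across ; adjacent = (λ eq → differ (cong mem (sym eq))) , across⇒trail ok ok′ (across-sym across)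
      ; limited = swap (Crossing.limited X) } , Φv , Φu

  module _ {p q : ℕ} (1≤p : 1 ≤ p) (1≤q : 1 ≤ q) (p≤ : 5 + p ≤ B) (q≤ : 5 + q ≤ B)
    (inside : Constant true mem (2 * (p * 3 ^ K)) (2 * 3 ^ K))
    (outside : Constant false mem (2 * (q * 3 ^ K)) (2 * 3 ^ K)) where

    -- Everything below p_{i, r·3^(K-i)} lies in the first 3^i of the 3^K even positions of the
    -- segment.
    constant-at : ∀ {v r i a} → i ≤ K → Constant v mem (2 * (r * 3 ^ K)) (2 * 3 ^ K) →
                  Below i (r * 3 ^ (K ∸ i)) a → mem (2 * a) ≡ v
    constant-at {v} {r} {i} {a} i≤K const b = trans
      (cong mem (sym (m+[n∸m]≡n (*-monoʳ-≤ 2 lower))))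
      (const (+-cancelˡ-< (2 * (r * 3 ^ K)) _ _ (begin-strict
      2 * (r * 3 ^ K) + (2 * a ∸ 2 * (r * 3 ^ K))  ≡⟨ m+[n∸m]≡n (*-monoʳ-≤ 2 lower) ⟩
      2 * a                                        <⟨ *-monoʳ-< 2 (below-upper i b) ⟩
      2 * (3 ^ i + r * 3 ^ (K ∸ i) * 3 ^ i)        ≡⟨ cong (λ z → 2 * (3 ^ i + z)) rescale ⟩
      2 * (3 ^ i + r * 3 ^ K)                      ≤⟨ *-monoʳ-≤ 2 (+-monoˡ-≤ (r * 3 ^ K) (^-monoʳ-≤ 3 i≤K)) ⟩
      2 * (3 ^ K + r * 3 ^ K)                      ≡⟨ shape (3 ^ K) (r * 3 ^ K) ⟩
      2 * (r * 3 ^ K) + 2 * 3 ^ K                  ∎)))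
      where
      open ≤-Reasoning
      shape : ∀ x y → 2 * (x + y) ≡ 2 * y + 2 * x
      shape = solve-∀
      rescale : r * 3 ^ (K ∸ i) * 3 ^ i ≡ r * 3 ^ K
      rescale = trans (*-assoc r _ _) (cong (r *_) (^-∸-* 3 i≤K))
      lower : r * 3 ^ K ≤ a
      lower = ≤-trans (≤-reflexive (sym rescale)) (below-lower i b)

    -- By `constant-at` the representatives of the blocks at `p` and `q` differ in membership, so
    -- membership changes between two consecutive blocks, to which `crossing` applies.
    link : ∀ {Φ} i → suc i ≤ K → Rep i Φ → Rep (suc i) Φ → Σ[ L ∈ Link (2 + i) ] Φ (x L) × Φ (y L)
    link {Φ} i i<K rep rep′ = between (≤-total (j p) (j q))
      where
      i≤K : i ≤ K
      i≤K = <⇒≤ i<K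
      j : ℕ → ℕ
      j r = r * 3 ^ (K ∸ i)
      χ : ℕ → Bool
      χ h = mem (2 * proj₁ (rep h))
      χp : χ (j p) ≡ true
      χp = constant-at {r = p} i≤K inside (proj₁ (proj₂ (rep (j p))))
      χq : χ (j q) ≡ false
      χq = constant-at {r = q} i≤K outside (proj₁ (proj₂ (rep (j q))))
      at : ∀ {r r'} → 1 ≤ r → 5 + r' ≤ B → (∃[ h ] j r ≤ h × h < j r' × χ h ≢ χ (suc h)) →
           Σ[ L ∈ Link (2 + i) ] Φ (x L) × Φ (y L)
      at {r} {r'} 1≤r r'≤ (h , r≤h , h<r' , ne) = orient i<K
        (enlarge (crossing (λ a → mem (2 * a)) Φ i rep rep′ h
          (≤-trans (*-mono-≤ 1≤r (m^n>0 3 (K ∸ i))) r≤h) ne))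
        where
        -- As h+1 ≤ r'·3^(K-i), the overshoot past r'·3^K is at most 5·3^i, whence the 5 in
        -- `5 + r' ≤ B`.
        bound : (6 + h) * 3 ^ i ≤ B * 3 ^ K
        bound = begin
          (6 + h) * 3 ^ i                            ≤⟨ *-monoˡ-≤ (3 ^ i) (≤-trans
                                                          (≤-reflexive (sym (+-suc 5 h))) (+-monoʳ-≤ 5 h<r')) ⟩
          (5 + r' * 3 ^ (K ∸ i)) * 3 ^ i             ≡⟨ shape r' (3 ^ (K ∸ i)) (3 ^ i) ⟩
          5 * 3 ^ i + r' * (3 ^ (K ∸ i) * 3 ^ i)     ≡⟨ cong (λ z → 5 * 3 ^ i + r' * z) (^-∸-* 3 i≤K) ⟩
          5 * 3 ^ i + r' * 3 ^ K                     ≤⟨ +-monoˡ-≤ (r' * 3 ^ K) (*-monoʳ-≤ 5 (^-monoʳ-≤ 3 i≤K)) ⟩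
          5 * 3 ^ K + r' * 3 ^ K                     ≡⟨ *-distribʳ-+ (3 ^ K) 5 r' ⟨
          (5 + r') * 3 ^ K                           ≤⟨ *-monoˡ-≤ (3 ^ K) r'≤ ⟩
          B * 3 ^ K                                  ∎
          where
          open ≤-Reasoning
          shape : ∀ r y z → (5 + r * y) * z ≡ 5 * z + r * (y * z)
          shape = solve-∀
        enlarge : ∀ {χ} → Crossing χ Φ i ((6 + h) * 3 ^ i) → Crossing χ Φ i (B * 3 ^ K)
        enlarge X = record { Crossing X ; bounded = ≤-trans (Crossing.bounded X) bound }
      between : j p ≤ j q ⊎ j q ≤ j p → Σ[ L ∈ Link (2 + i) ] Φ (x L) × Φ (y L)
      between (inj₁ le) = at {p} {q} 1≤p q≤ (change χ le (λ eq → not-¬ (trans (sym χp) (trans eq χq)) refl))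
      between (inj₂ le) = at {q} {p} 1≤q p≤ (change χ le (λ eq → not-¬ (trans (sym χq) (trans eq χp)) refl))

    record Links (n : ℕ) : Set where
      field
        links    : Fin n → Link (level n)
        distinct : ∀ {a b} → a Fin.< b → col (2 * x (links a)) ≢ col (2 * x (links b))

    links : ∀ n → level n ≤ K → Links n
    links zero    _  = record { links = λ () ; distinct = λ { {()} } }
    links (suc n) le with links n (≤-trans (level-step n) le)
    ... | record { links = old ; distinct = distinct } = record { links = all ; distinct = distinct′ }
      where
      i : ℕ
      i = level n + (n + n) + 2
      -- Both ends of every earlier link are avoided, as either may be the limited one.
      ends : Fin (n + n) → ℕ
      ends c = [ x ∘ old , y ∘ old ]′ (splitAt n c)
      new : Σ[ L ∈ Link (2 + i) ] FarFrom (level n) ends (x L) × FarFrom (level n) ends (y L)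
      new = link i (≤-trans (n≤1+n _) le) (far-rep (level n) ends i ≤-refl) (far-rep (level n) ends (suc i) (n≤1+n i))
      all : Fin (suc n) → Link (level (suc n))
      all Fin.zero    = proj₁ new
      all (Fin.suc a) = weaken (level-step n) (old a)
      far-x : ∀ {z} → FarFrom (level n) ends z → ∀ a → Far (level n) z (x (old a))
      far-x {z} far a = subst (λ c → Far (level n) z ([ x ∘ old , y ∘ old ]′ c)) (splitAt-↑ˡ n a n) (far (a ↑ˡ n))
      far-y : ∀ {z} → FarFrom (level n) ends z → ∀ a → Far (level n) z (y (old a))
      far-y {z} far a = subst (λ c → Far (level n) z ([ x ∘ old , y ∘ old ]′ c)) (splitAt-↑ʳ n n a) (far (n ↑ʳ a))
      distinct′ : ∀ {a b} → a Fin.< b → col (2 * x (all a)) ≢ col (2 * x (all b))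
      distinct′ {Fin.zero} {Fin.suc b} _ = far⇒distinct (old b) (proj₁ new)
        (far-y (proj₁ (proj₂ new)) b) (far-x (proj₂ (proj₂ new)) b)
      distinct′ {Fin.suc a} {Fin.suc b} (s≤s a<b) = distinct a<b

    no-cut : level (suc w) ≤ K → ⊥
    no-cut le with links (suc w) le
    ... | record { links = old ; distinct = distinct } with pigeonhole ≤-refl (λ a → col (2 * x (old a)))
    ...   | _ , _ , a<b , eq = distinct a<b eq

-- Choice of parameters and conclusion.

n<3^n : ∀ n → n < 3 ^ n
n<3^n zero    = s≤s z≤n
n<3^n (suc n) = ≤-trans (+-mono-≤ (m^n>0 3 n) (n<3^n n)) (+-monoʳ-≤ (3 ^ n) (m≤m+n (3 ^ n) _))

module _ (w : ℕ) where

  -- `K` leaves scales for w+1 links, `B` is the largest block index 2(2w+1) plus 5, and `k` makes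
  -- 2B·3^K smaller than 3^k because 2B < 3^(2B).
  K B k : ℕ
  K = level (suc w)
  B = 7 + 2 * (w + w)
  k = 2 * B + K

  Q : ℕ
  Q = 3 ^ K

  room : 2 * (B * Q) < 3 ^ k
  room = subst₂ _<_ (*-assoc 2 B Q) (sym (^-distribˡ-+-* 3 (2 * B) K)) (*-monoˡ-< Q {{m^n≢0 3 K}} (n<3^n (2 * B)))

  block : Fin (suc (w + w)) → ℕ
  block s = 2 * suc (toℕ s)

  block≤ : ∀ s → 5 + block s ≤ B
  block≤ s = ≤-trans (+-monoʳ-≤ 5 (*-monoʳ-≤ 2 (toℕ<n s))) (≤-reflexive (shape (w + w)))
    where
    shape : ∀ x → 5 + 2 * suc x ≡ 7 + 2 * x
    shape = solve-∀

  base : Fin (suc (w + w)) → ℕ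
  base s = 2 * (block s * Q)

  end≡ : ∀ r → 2 * (r * Q) + 2 * Q ≡ 2 * (suc r * Q)
  end≡ r = shape r Q
    where
    shape : ∀ r x → 2 * (r * x) + 2 * x ≡ 2 * (suc r * x)
    shape = solve-∀

  gap : ∀ {i j} → i Fin.< j → base i + 2 * Q < base j
  gap {i} {j} i<j = ≤-<-trans (≤-reflexive (end≡ (block i))) (*-monoʳ-< 2 (*-monoˡ-< Q {{m^n≢0 3 K}}
    (≤-trans (≤-reflexive (shape (toℕ i))) (*-monoʳ-≤ 2 (s≤s i<j)))))
    where
    shape : ∀ a → suc (suc (2 * suc a)) ≡ 2 * suc (suc a)
    shape = solve-∀

  fits : ∀ s → base s + 2 * Q ≤ 3 ^ k
  fits s = ≤-trans (≤-reflexive (end≡ (block s)))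
    (≤-trans (*-monoʳ-≤ 2 (*-monoˡ-≤ Q (≤-trans (m≤n+m _ 4) (block≤ s)))) (<⇒≤ room))

  unbounded : ¬ CliqueWidth≤ w (G k)
  unbounded (n , e , σ , iso) = conclude (separating base (*-monoʳ-≤ 2 (m^n>0 3 K)) gap fits e ι root onto)
    where
    open Inverse σ
    ι : Fin n → ℕ
    ι x = toℕ (to x)
    preimage : ∀ {y} (y< : y < 3 ^ k) → ι (from (fromℕ< y<)) ≡ y
    preimage y< = trans (cong toℕ (strictlyInverseˡ (fromℕ< y<))) (toℕ-fromℕ< y<)
    root : Embedded e ι
    root = record
      -- At the root no operations follow and no vertices lie outside.
      { later = λ _ _ → ⊥
      ; inside = λ x y → mk⇔ (inj₁ ∘ Equivalence.from (iso x y)) [ Equivalence.to (iso x y) , ⊥-elim ]′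
      ; outside = λ y< y∉ → ⊥-elim (y∉ _ (preimage y<)) }
    onto : ∀ {y} → y < 3 ^ k → image {k} {w} ι y ≡ true
    onto y< = dec-true (image? {k} {w} ι _) (_ , preimage y<)
    conclude : Σ[ C ∈ Cut {k} {w} ] (∃[ s ] Constant true (Cut.mem C) (base s) (2 * Q)) ×
               (∃[ s ] Constant false (Cut.mem C) (base s) (2 * Q)) → ⊥
    conclude (C , (s , solid) , (t , hollow)) =
      no-cut C K B (m<n+m K {2 * B} (s≤s z≤n)) room {p = block s} {q = block t}
        (s≤s z≤n) (s≤s z≤n) (block≤ s) (block≤ t) solid hollow ≤-refl

theorem17 : (w : ℕ) → ∃[ k ] (1 ≤ k × ¬ CliqueWidth≤ w (G k))
theorem17 w = k w , s≤s z≤n , unbounded w
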